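{- The first moment of the one-parameter family $E: y^2=4x^3+ax^2+bx+c+dt$ (with parameter $t$ and integer coefficients $a,b,c,d$) is $0$, that is, $A_{1,E}(p)=0$.
   Context: Here $p$ is an odd prime and $\left(\frac{\cdot}{p}\right)$ denotes the Legendre symbol, with $\left(\frac{u}{p}\right)=0$ if $p\mid u$. For a family $y^2=f_t(x)$, with $f_t(x)$ a cubic polynomial in $x$ whose coefficients are integer polynomials in $t$, one sets $a_t(p):=p-\#\{(x,y)\in(\mathbb{Z}/p\mathbb{Z})^2: y^2\equiv f_t(x) \bmod p\}=-\sum_{x \bmod p}\left(\frac{f_t(x)}{p}\right)$. The first moment of the family is $A_{1,E}(p):=\frac1p\sum_{t \bmod p}a_t(p)$, the sum running over all residues $t$ modulo $p$.
   Formalization: The formal theorem adds the hypothesis that p does not divide d; without it the claim fails, e.g. for p=5, a=0, b=4, c=0, d=5 the family is constant mod 5 and its first moment is 2. -}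

module Defs where

import Algebra.Properties.CommutativeMonoid.Sum as CMSum
open import Data.Fin using (Fin; toℕ)
open import Data.Integer using (ℤ; +_; _+_; _-_; _*_; _^_)
open import Data.Integer.Divisibility.Signed using (_∣_; _∣?_)
open import Data.Integer.Properties using (+-0-commutativeMonoid)
open import Data.List using (List; allFin; cartesianProduct; filter; length)
open import Data.Nat using (ℕ; NonZero)
open import Data.Product using (_×_; _,_)
open import Data.Rational using (ℚ; _/_)
open import Relation.Nullary using (Dec)

open CMSum +-0-commutativeMonoid using (sum-syntax)

infix 4 _≡_[mod_] _≡?_[mod_]

_≡_[mod_] : ℤ → ℤ → ℕ → Set
u ≡ v [mod p ] = + p ∣ u - v

_≡?_[mod_] : ∀ u v p → Dec (u ≡ v [mod p ])
u ≡? v [mod p ] = + p ∣? u - v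

-- Fin p stands for ℤ/pℤ, a class being given by its representative in
-- {0, …, p - 1}.
⟦_⟧ : ∀ {p} → Fin p → ℤ
⟦ x ⟧ = + toℕ x

points : (p : ℕ) → (ℤ → ℤ) → List (Fin p × Fin p)
points p g =
  filter (λ (x , y) → ⟦ y ⟧ ^ 2 ≡? g ⟦ x ⟧ [mod p ])
         (cartesianProduct (allFin p) (allFin p))

-- A family y² = f_t(x) is given by (t , x) ↦ f_t(x) on ℤ.  The counts below
-- depend only on residue classes when f is a polynomial in t and x with
-- integer coefficients, which is the intended use.
Family : Set
Family = ℤ → ℤ → ℤ

trace : Family → (p : ℕ) → ℤ → ℤ
trace f p t = + p - + length (points p (f t))

firstMoment : Family → (p : ℕ) .{{_ : NonZero p}} → ℚ
firstMoment f p = (∑[ t < p ] trace f p ⟦ t ⟧) / p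

cubicFamily : (a b c d : ℤ) → Family
cubicFamily a b c d t x = + 4 * x ^ 3 + a * x ^ 2 + b * x + c + d * t

{-# OPTIONS --safe #-}
-- Since p does not divide d, for every pair (x , y) the congruence
-- y² ≡ f_t(x) mod p is linear in t with an invertible coefficient, so it has
-- exactly one solution t.  Counting triples (t , x , y) by their last two
-- coordinates gives p² points in the whole family, which cancels the p
-- summands p of the first moment.
module Submission where

open import Defs
open import Algebra.Bundles using (AbelianGroup)
import Algebra.Properties.CommutativeMonoid.Sum as CMSum
import Algebra.Properties.Group as GroupProperties
open import Data.Empty using (⊥-elim)
open import Data.Fin using (Fin; toℕ; fromℕ<)
open import Data.Fin.Properties using (toℕ-injective; toℕ-fromℕ<; toℕ<n; punchInᵢ≢i)
open import Data.Integer using (ℤ; +_; 0ℤ; 1ℤ; _+_; _-_; -_; _*_; _^_; ∣_∣; _/ℕ_; _%ℕ_)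
open import Data.Integer.Divisibility.Signed
  using (_∣_; divides; ∣ᵤ⇒∣; ∣⇒∣ᵤ; m∣∣m∣; ∣n⇒∣m*n; ∣m∣n⇒∣m+n; ∣m∣n⇒∣m-n)
open import Data.Integer.DivMod using (n%ℕd<d; a≡a%ℕn+[a/ℕn]*n)
open import Data.Integer.Properties
  using (+-0-commutativeMonoid; +-0-abelianGroup; +-identityʳ; +-injective;
         pos-*; suc-*; ∣i∣≡0⇒i≡0; i-j≡0⇒i≡j; m-n≡m⊖n; ∣m⊝n∣≤m⊔n)
open import Data.Integer.Tactic.RingSolver using (solve-∀)
open import Data.List using (List; []; _∷_; [_]; allFin; cartesianProduct; filter; length; map)
open import Data.List.Properties
  using (filter-++; filter-accept; filter-reject; length-++; length-map; length-tabulate)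
open import Data.Nat as ℕ using (ℕ; NonZero)
open import Data.Nat.Coprimality using (Coprime; coprime-Bézout)
open import Data.Nat.Divisibility using (_∤_; ∣⇒≤)
open import Data.Nat.GCD using (module Bézout)
open import Data.Nat.Primality using (Prime; prime⇒irreducible)
import Data.Nat.Properties as ℕ
open import Data.Product using (∃; ∃!; _,_)
open import Data.Rational using (0ℚ; _/_)
open import Data.Rational.Properties using (0/n≡0)
open import Data.Sum using (inj₁; inj₂)
open import Function using (id; _∘_)
open import Relation.Binary.PropositionalEquality
  using (_≡_; _≢_; refl; sym; trans; cong; cong₂; subst; module ≡-Reasoning)
open import Relation.Nullary using (¬_)
open import Relation.Unary using (Decidable)

open GroupProperties (AbelianGroup.group +-0-abelianGroup) using (identityˡ-unique)
open CMSum +-0-commutativeMonoid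
  using (sum; sum-syntax; sum-cong-≗; sum-remove; sum-replicate-zero; ∑-distrib-+)

∑-const : ∀ n z → ∑[ i < n ] z ≡ + n * z
∑-const ℕ.zero    z = refl
∑-const (ℕ.suc n) z = trans (cong (_+_ z) (∑-const n z)) (sym (suc-* (+ n) z))

∑-support-singleton : ∀ {n} (f : Fin n → ℤ) i → (∀ j → i ≢ j → f j ≡ 0ℤ) →
                      ∑[ j < n ] f j ≡ f i
∑-support-singleton {ℕ.suc n} f i f≡0 = begin
  sum f                ≡⟨ sum-remove {i = i} f ⟩
  -- The remaining indices have the form `punchIn i j`, which never equals `i`, so every other term
  -- vanishes.
  f i + sum {n} _      ≡⟨ cong (_+_ (f i)) (sum-cong-≗ λ j → f≡0 _ (punchInᵢ≢i i j ∘ sym)) ⟩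
  f i + ∑[ j < n ] 0ℤ  ≡⟨ cong (_+_ (f i)) (sum-replicate-zero n) ⟩
  f i + 0ℤ             ≡⟨ +-identityʳ (f i) ⟩
  f i                  ∎
  where open ≡-Reasoning

module _ {A : Set} {n} {P : Fin n → A → Set} (P? : ∀ t → Decidable (P t))
         (unique : ∀ x → ∃! _≡_ (λ t → P t x)) where

  private
    count : List A → Fin n → ℤ
    count xs t = + length (filter (P? t) xs)

  -- Filtering `[ x ]` by `P t` keeps `x` at the unique `t₀` and leaves the empty list at every
  -- other `t`.
  ∑-count-singleton : ∀ x → ∑[ t < n ] count [ x ] t ≡ 1ℤ
  ∑-count-singleton x with unique x
  ... | t₀ , Pt₀ , t₀-unique = trans
    (∑-support-singleton (count [ x ]) t₀
      λ t t₀≢t → cong (+_ ∘ length) (filter-reject (P? t) (t₀≢t ∘ t₀-unique)))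
    (cong (+_ ∘ length) (filter-accept (P? t₀) Pt₀))

  -- Double counting: each entry is kept by the filter for exactly one `t`, so it contributes 1 to
  -- the total. Viewing `x ∷ xs` as `[ x ] ++ xs` makes the count additive, which reduces the
  -- induction to singletons.
  ∑-count : ∀ xs → ∑[ t < n ] count xs t ≡ + length xs
  ∑-count []       = sum-replicate-zero n
  ∑-count (x ∷ xs) = begin
    ∑[ t < n ] count (x ∷ xs) t
      ≡⟨ sum-cong-≗ count-∷ ⟩
    ∑[ t < n ] (count [ x ] t + count xs t)
      ≡⟨ ∑-distrib-+ (count [ x ]) (count xs) ⟩
    ∑[ t < n ] count [ x ] t + ∑[ t < n ] count xs t
      ≡⟨ cong₂ _+_ (∑-count-singleton x) (∑-count xs) ⟩
    + length (x ∷ xs) ∎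
    where
    open ≡-Reasoning
    count-∷ : ∀ t → count (x ∷ xs) t ≡ count [ x ] t + count xs t
    count-∷ t = cong +_ (trans
      (cong length (filter-++ (P? t) [ x ] xs))
      (length-++ (filter (P? t) [ x ])))

length-cartesianProduct : ∀ {A B : Set} (xs : List A) (ys : List B) →
  length (cartesianProduct xs ys) ≡ length xs ℕ.* length ys
length-cartesianProduct []       ys = refl
length-cartesianProduct (x ∷ xs) ys = trans
  (length-++ (map (x ,_) ys))
  (cong₂ ℕ._+_ (length-map (x ,_) ys) (length-cartesianProduct xs ys))

-- A common divisor of `n` and `p` is 1 or `p` because `p` is irreducible, and `p` is excluded by
-- assumption.
∤⇒coprime : ∀ {p n} → Prime p → p ∤ n → Coprime n p
∤⇒coprime p-prime p∤n (k∣n , k∣p) with prime⇒irreducible p-prime k∣p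
... | inj₁ k≡1  = k≡1
... | inj₂ refl = ⊥-elim (p∤n k∣n)

ℕ-inverse : ∀ {m n} → Coprime m n → ∃ λ e → e * + m ≡ + 1 [mod n ]
ℕ-inverse {m} {n} coprime with coprime-Bézout coprime
... | Bézout.+- x y 1+yn≡xm = + x , divides (+ y) (begin
  + x * + m - 1ℤ           ≡⟨ cong (_- 1ℤ) (pos-* x m) ⟨
  + (x ℕ.* m) - 1ℤ         ≡⟨ cong (λ k → + k - 1ℤ) 1+yn≡xm ⟨
  + (1 ℕ.+ y ℕ.* n) - 1ℤ   ≡⟨⟩
  + (y ℕ.* n)              ≡⟨ pos-* y n ⟩
  + y * + n                ∎)
  where open ≡-Reasoning
-- Bézout coefficients over ℕ come in two sign patterns. Here `1 + x m = y n`, so `x m` is -1 modulo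
-- `n` and the inverse is `- x`.
... | Bézout.-+ x y 1+xm≡yn = - + x , divides (- + y) (begin
  - + x * + m - 1ℤ         ≡⟨ factor (+ x) (+ m) ⟩
  - (1ℤ + + x * + m)       ≡⟨ cong (λ k → - (1ℤ + k)) (pos-* x m) ⟨
  - (+ (1 ℕ.+ x ℕ.* m))    ≡⟨ cong (-_ ∘ +_) 1+xm≡yn ⟩
  - (+ (y ℕ.* n))          ≡⟨ cong -_ (pos-* y n) ⟩
  - (+ y * + n)            ≡⟨ neg (+ y) (+ n) ⟩
  - + y * + n              ∎)
  where
  open ≡-Reasoning
  factor : ∀ x m → - x * m - 1ℤ ≡ - (1ℤ + x * m)
  factor = solve-∀
  neg : ∀ y n → - (y * n) ≡ - y * n
  neg = solve-∀

-- Since `∣ d ∣ = q * d` for some integer `q`, an inverse `e` of `∣ d ∣` yields the inverse `e * q`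
-- of `d`.
inverse : ∀ d {n} → Coprime ∣ d ∣ n → ∃ λ e → e * d ≡ + 1 [mod n ]
inverse d {n} coprime with ℕ-inverse coprime | m∣∣m∣ {d}
... | e , n∣e∣d∣-1 | divides q ∣d∣≡qd =
  e * q , subst (λ k → + n ∣ k - 1ℤ) (trans (cong (e *_) ∣d∣≡qd) (assoc e q d)) n∣e∣d∣-1
  where
  assoc : ∀ e q d → e * (q * d) ≡ e * q * d
  assoc = solve-∀

-- Both representatives lie in {0, ..., n - 1}, so their difference has absolute value below `n`;
-- the only such multiple of `n` is 0.
⟦⟧-injective : ∀ {n} (s t : Fin n) → ⟦ s ⟧ ≡ ⟦ t ⟧ [mod n ] → s ≡ t
⟦⟧-injective {n} s t n∣s-t = toℕ-injective (+-injective (i-j≡0⇒i≡j _ _ (∣i∣≡0⇒i≡0 ∣s-t∣≡0)))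
  where
  ∣s-t∣<n : ∣ ⟦ s ⟧ - ⟦ t ⟧ ∣ ℕ.< n
  ∣s-t∣<n = ℕ.≤-<-trans
    (subst (λ k → ∣ k ∣ ℕ.≤ toℕ s ℕ.⊔ toℕ t) (sym (m-n≡m⊖n (toℕ s) (toℕ t)))
           (∣m⊝n∣≤m⊔n (toℕ s) (toℕ t)))
    (ℕ.⊔-lub (toℕ<n s) (toℕ<n t))

  ∣s-t∣≡0 : ∣ ⟦ s ⟧ - ⟦ t ⟧ ∣ ≡ 0
  ∣s-t∣≡0 with ∣ ⟦ s ⟧ - ⟦ t ⟧ ∣ | ∣s-t∣<n | ∣⇒∣ᵤ n∣s-t
  ... | ℕ.zero  | _   | _   = refl
  ... | ℕ.suc _ | k<n | n∣k = ⊥-elim (ℕ.<⇒≱ k<n (∣⇒≤ n∣k))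

representative : ∀ n .{{_ : NonZero n}} u → ∃ λ (t : Fin n) → u ≡ ⟦ t ⟧ [mod n ]
representative n u = fromℕ< (n%ℕd<d u n) , divides (u /ℕ n) (begin
  u - + toℕ (fromℕ< (n%ℕd<d u n))          ≡⟨ cong (λ k → u - + k) (toℕ-fromℕ< (n%ℕd<d u n)) ⟩
  u - r                                    ≡⟨ cong (_- r) (a≡a%ℕn+[a/ℕn]*n u n) ⟩
  r + (u /ℕ n) * + n - r                   ≡⟨ cancel r ((u /ℕ n) * + n) ⟩
  (u /ℕ n) * + n                           ∎)
  where
  open ≡-Reasoning
  r = + (u %ℕ n)
  cancel : ∀ i j → i + j - i ≡ j
  cancel = solve-∀

-- With `e` inverse to `d`, the solution is the class of `e * (u - k)`. Both halves exhibit the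
-- required difference as an integer combination of quantities already known to be divisible by `n`.
linear-congruence : ∀ d n .{{_ : NonZero n}} → Coprime ∣ d ∣ n → ∀ u k →
  ∃! _≡_ (λ (t : Fin n) → u ≡ k + d * ⟦ t ⟧ [mod n ])
linear-congruence d n coprime u k with inverse d coprime
... | e , n∣ed-1 with representative n (e * (u - k))
... | t , n∣e[u-k]-t = t , solves , λ {s} → unique s
  where
  solves : u ≡ k + d * ⟦ t ⟧ [mod n ]
  solves = subst (+ n ∣_) (identity d e u k ⟦ t ⟧)
    (∣m∣n⇒∣m-n (∣n⇒∣m*n d n∣e[u-k]-t) (∣n⇒∣m*n (u - k) n∣ed-1))
    where
    identity : ∀ d e u k t →
      d * (e * (u - k) - t) - (u - k) * (e * d - 1ℤ) ≡ u - (k + d * t)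
    identity = solve-∀

  unique : ∀ s → u ≡ k + d * ⟦ s ⟧ [mod n ] → t ≡ s
  unique s n∣u-k-ds = ⟦⟧-injective t s (subst (+ n ∣_) (identity d e u k ⟦ s ⟧ ⟦ t ⟧)
    (∣m∣n⇒∣m-n
      (∣m∣n⇒∣m+n (∣n⇒∣m*n e n∣u-k-ds) (∣n⇒∣m*n ⟦ s ⟧ n∣ed-1))
      n∣e[u-k]-t))
    where
    identity : ∀ d e u k s t →
      e * (u - (k + d * s)) + s * (e * d - 1ℤ) - (e * (u - k) - t) ≡ t - s
    identity = solve-∀

∑-points : ∀ (g : ℤ → ℤ) d p .{{_ : NonZero p}} → Coprime ∣ d ∣ p →
  ∑[ t < p ] (+ length (points p (λ x → g x + d * ⟦ t ⟧))) ≡ + p * + p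
∑-points g d p coprime = begin
  ∑[ t < p ] (+ length (points p (λ x → g x + d * ⟦ t ⟧)))
    -- `points` filters the same list of pairs for every `t`; only the predicate depends on `t`.
    ≡⟨ ∑-count
         (λ t (x , y) → ⟦ y ⟧ ^ 2 ≡? g ⟦ x ⟧ + d * ⟦ t ⟧ [mod p ])
         (λ (x , y) → linear-congruence d p coprime (⟦ y ⟧ ^ 2) (g ⟦ x ⟧))
         (cartesianProduct (allFin p) (allFin p)) ⟩
  + length (cartesianProduct (allFin p) (allFin p))
    ≡⟨ cong +_ (length-cartesianProduct (allFin p) (allFin p)) ⟩
  + (length (allFin p) ℕ.* length (allFin p))
    ≡⟨ cong (λ m → + (m ℕ.* m)) (length-tabulate {n = p} id) ⟩
  + (p ℕ.* p)
    ≡⟨ pos-* p p ⟩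
  + p * + p ∎
  where open ≡-Reasoning

-- For each `t` the trace and the point count add up to `p`, and there are `p` values of `t`. The
-- additive form lets the sum of traces be found by cancellation.
∑-trace : ∀ (f : Family) p →
  ∑[ t < p ] trace f p ⟦ t ⟧ + ∑[ t < p ] (+ length (points p (f ⟦ t ⟧))) ≡ + p * + p
∑-trace f p = begin
  ∑[ t < p ] trace f p ⟦ t ⟧ + ∑[ t < p ] N t  ≡⟨ ∑-distrib-+ (λ t → trace f p ⟦ t ⟧) N ⟨
  ∑[ t < p ] (trace f p ⟦ t ⟧ + N t)           ≡⟨ sum-cong-≗ (λ t → cancel (+ p) (N t)) ⟩
  ∑[ t < p ] (+ p)                             ≡⟨ ∑-const p (+ p) ⟩
  + p * + p                                    ∎
  where
  open ≡-Reasoning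
  N : Fin p → ℤ
  N t = + length (points p (f ⟦ t ⟧))
  cancel : ∀ i j → i - j + j ≡ i
  cancel = solve-∀

lemma2p1 : (a b c d : ℤ) (p : ℕ) .{{_ : NonZero p}} →
    Prime p → 2 ∤ p → ¬ (+ p ∣ d) →
    firstMoment (cubicFamily a b c d) p ≡ 0ℚ
lemma2p1 a b c d p p-prime _ p∤d = trans (cong (_/ p) ∑-trace≡0) (0/n≡0 p)
  where
  f = cubicFamily a b c d
  -- The part free of `t`. As `_+_` associates to the left, `f t x` is `g x + d * t` by definition,
  -- so `∑-points` applies directly.
  g : ℤ → ℤ
  g x = + 4 * x ^ 3 + a * x ^ 2 + b * x + c

  ∑-trace≡0 : ∑[ t < p ] trace f p ⟦ t ⟧ ≡ 0ℤ
  -- Adding p² to the sum of traces gives p² again, so that sum is 0.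
  ∑-trace≡0 = identityˡ-unique _ (+ p * + p) (begin
    ∑[ t < p ] trace f p ⟦ t ⟧ + + p * + p
      ≡⟨ cong (_+_ (∑[ t < p ] trace f p ⟦ t ⟧))
              (∑-points g d p (∤⇒coprime p-prime (p∤d ∘ ∣ᵤ⇒∣))) ⟨
    ∑[ t < p ] trace f p ⟦ t ⟧ + ∑[ t < p ] (+ length (points p (f ⟦ t ⟧)))
      ≡⟨ ∑-trace f p ⟩
    + p * + p ∎)
    where open ≡-Reasoning
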